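{- Let $\vec a=(a_1,a_2,a_3)$ be a vector of relatively prime positive integers. Let $(v_1,v_2)$ be a $\mathbb{Z}$-basis of $\operatorname{Ker}\mathcal{F}'_{\vec a}$, let $P=\{\alpha v_1+\beta v_2:0\le\alpha,\beta\le1\}\subset\mathcal{D}$ be the corresponding parallelogram, and let $\rho(x)=v_1+v_2-x$ be the symmetry of $\mathcal{D}$ with respect to the center of $P$. Then: (i) the body of the Christoffel parallelogram on $P$ is symmetric with respect to the center of $P$: $\rho(\mathrm{Tr}_P(I_{\vec a}\setminus\mathcal{Q}'))=\mathrm{Tr}_P(I_{\vec a}\setminus\mathcal{Q}')$; (ii) the parallelogram obtained from the Christoffel parallelogram on $P$ by symmetry with respect to its center appears in $I_{\vec a}$ at a translate of $P$, and is also equal to the flip of the Christoffel parallelogram: there exists $t\in L$ such that $\rho(\mathrm{Tr}_P(I_{\vec a}))=\mathrm{Tr}_{P+t}(I_{\vec a})-t$, and moreover $\rho(\mathrm{Tr}_P(I_{\vec a}))=\mathrm{Tr}_P(\mathrm{flip}(I_{\vec a}))$.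
   Context: "Relatively prime" means $\gcd(a_1,a_2,a_3)=1$; $s=a_1+a_2+a_3$. $\mathcal{D}$ is the plane $x_1+x_2+x_3=0$ in $\mathbb{R}^3$, $\pi:\mathbb{R}^3\to\mathcal{D}$ is the orthogonal projection, $h_i=\pi(e_i)$ (so $h_1+h_2+h_3=0$), and $L=\pi(\mathbb{Z}^3)$ is the lattice spanned by $h_1,h_2,h_3$, identified with $\mathbb{Z}^3/(1,1,1)\mathbb{Z}$. $\mathcal{F}'_{\vec a}:L\to\mathbb{Z}/s\mathbb{Z}$ is the homomorphism with $\mathcal{F}'_{\vec a}(h_i)=a_i \bmod s$; $\mathbb{Z}/s\mathbb{Z}$ is identified with $\{0,\ldots,s-1\}$ with its usual order. Edges are the pairs $(l,l+h_i)$ with $l\in L$, $1\le i\le3$. The graph $I_{\vec a}$ is the set of edges $(l,l+h_i)$ with $\mathcal{F}'_{\vec a}(l)<\mathcal{F}'_{\vec a}(l+h_i)$. $\mathcal{Q}'$ is the set of edges $(l,l+h_i)$ with $\mathcal{F}'_{\vec a}(l)=0$ or $\mathcal{F}'_{\vec a}(l+h_i)=0$; for a set $X$ of edges, $\mathrm{flip}(X)=(X\setminus\mathcal{Q}')\cup(\mathcal{Q}'\setminus X)$. A Christoffel parallelogram is a parallelogram $P$ with a vertex at the origin that is a fundamental domain of $\mathcal{D}$ for the discrete group $\operatorname{Ker}\mathcal{F}'_{\vec a}$, together with the parts of the edges of $I_{\vec a}$ (viewed as segments) lying in $P$; its body is formed by the parts of edges not in $\mathcal{Q}'$, and its flip is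 obtained by exchanging the edges incident to zero. Formally, for a set $X$ of edges and a parallelogram $P\subset\mathcal{D}$, $\mathrm{Tr}_P(X)$ denotes the set of pairs $(i,[l,l+h_i]\cap P)$ over all edges $(l,l+h_i)\in X$ whose segment $[l,l+h_i]$ meets $P$. Affine maps of $\mathcal{D}$ such as $\rho$ and translations act on such pairs by $(i,\sigma)\mapsto(i,\rho(\sigma))$, keeping the label $i$ (the reversal of an edge $(u,v)$ being $(-v,-u)$, which is again an edge in direction $h_i$). -}

module Defs where

open import Level using (0ℓ; _⊔_) renaming (suc to lsuc)
open import Data.Nat as ℕ using (ℕ)
import Data.Nat.Properties as ℕ
open import Data.Integer as ℤ using (ℤ; 0ℤ; 1ℤ; +_)
open import Data.Integer.DivMod using (_%ℕ_)
open import Data.Rational as ℚ using (ℚ; 0ℚ; 1ℚ; ½)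
import Data.Rational.Properties as ℚ
open import Data.Rational.Solver using (module +-*-Solver)
open import Data.Fin using (Fin; _≟_)
open import Data.Fin.Patterns using (0F; 1F; 2F)
open import Data.Bool using (if_then_else_)
open import Data.Product using (∃; ∃₂; _×_; _,_)
open import Data.Sum using (_⊎_)
open import Data.Vec.Functional using (Vector; map; zipWith)
open import Relation.Nullary.Decidable using (does)
open import Relation.Unary using (Pred; _∈_; _∩_; _∪_; _∖_; _≐_; Satisfiable)
open import Relation.Binary.PropositionalEquality
  using (_≡_; refl; sym; trans; cong; subst)

-- Real numbers are Cauchy sequences of rationals up to _≈_.  The auxiliary
-- lemmas are abstract because unfolding ring-solver proofs during type
-- checking is prohibitively slow.

private abstract
  pos-* : ∀ {p q} → 0ℚ ℚ.< p → 0ℚ ℚ.< q → 0ℚ ℚ.< p ℚ.* q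
  pos-* {p} {q} 0<p 0<q =
    ℚ.positive⁻¹ (p ℚ.* q)
      {{ℚ.pos*pos⇒pos p {{ℚ.positive 0<p}} q {{ℚ.positive 0<q}}}}

  half-pos : ∀ {ε} → 0ℚ ℚ.< ε → 0ℚ ℚ.< ½ ℚ.* ε
  half-pos = pos-* (ℚ.positive⁻¹ ½)

  halves : ∀ ε → ½ ℚ.* ε ℚ.+ ½ ℚ.* ε ≡ ε
  halves ε = trans (sym (ℚ.*-distribʳ-+ ε ½ ½)) (ℚ.*-identityˡ ε)

record ℝ : Set where
  constructor mkℝ
  field
    seq    : ℕ → ℚ
    cauchy : ∀ ε → 0ℚ ℚ.< ε → ∃ λ N → ∀ m n → N ℕ.≤ m → N ℕ.≤ n →
             ℚ.∣ seq m ℚ.- seq n ∣ ℚ.≤ ε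

open ℝ public

infix 4 _≈_ _≤ʳ_

_≈_ : ℝ → ℝ → Set
x ≈ y = ∀ ε → 0ℚ ℚ.< ε → ∃ λ N → ∀ n → N ℕ.≤ n →
        ℚ.∣ seq x n ℚ.- seq y n ∣ ℚ.≤ ε

_≤ʳ_ : ℝ → ℝ → Set
x ≤ʳ y = ∀ ε → 0ℚ ℚ.< ε → ∃ λ N → ∀ n → N ℕ.≤ n →
         seq x n ℚ.≤ seq y n ℚ.+ ε

private abstract
  eventually-bounded : ∀ x → ∃₂ λ B N → 0ℚ ℚ.< B ×
                       (∀ n → N ℕ.≤ n → ℚ.∣ seq x n ∣ ℚ.≤ B)
  eventually-bounded x with cauchy x 1ℚ (ℚ.positive⁻¹ 1ℚ)
  ... | N , c = 1ℚ ℚ.+ ℚ.∣ seq x N ∣ , N , B>0 , bound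
    where
    B>0 : 0ℚ ℚ.< 1ℚ ℚ.+ ℚ.∣ seq x N ∣
    B>0 = ℚ.+-mono-<-≤ (ℚ.positive⁻¹ 1ℚ) (ℚ.0≤∣p∣ (seq x N))

    bound : ∀ n → N ℕ.≤ n → ℚ.∣ seq x n ∣ ℚ.≤ 1ℚ ℚ.+ ℚ.∣ seq x N ∣
    bound n N≤n = begin
      ℚ.∣ seq x n ∣                                ≡⟨ cong ℚ.∣_∣ (split (seq x n) (seq x N)) ⟩
      ℚ.∣ (seq x n ℚ.- seq x N) ℚ.+ seq x N ∣      ≤⟨ ℚ.∣p+q∣≤∣p∣+∣q∣ (seq x n ℚ.- seq x N) (seq x N) ⟩
      ℚ.∣ seq x n ℚ.- seq x N ∣ ℚ.+ ℚ.∣ seq x N ∣  ≤⟨ ℚ.+-monoˡ-≤ ℚ.∣ seq x N ∣ (c n N N≤n ℕ.≤-refl) ⟩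
      1ℚ ℚ.+ ℚ.∣ seq x N ∣                         ∎
      where
      open ℚ.≤-Reasoning
      open +-*-Solver
      split : ∀ a b → a ≡ (a ℚ.- b) ℚ.+ b
      split = solve 2 (λ a b → a := (a :- b) :+ b) refl

fromℚ : ℚ → ℝ
fromℚ q = mkℝ (λ _ → q) λ ε ε>0 → 0 , λ _ _ _ _ →
  subst (ℚ._≤ ε) (cong ℚ.∣_∣ (sym (ℚ.+-inverseʳ q))) (ℚ.<⇒≤ ε>0)

fromℤ : ℤ → ℝ
fromℤ k = fromℚ (k ℚ./ 1)

0ʳ 1ʳ ⅓ : ℝ
0ʳ = fromℚ 0ℚ
1ʳ = fromℚ 1ℚ
⅓  = fromℚ (1ℤ ℚ./ 3)

infix  8 -ʳ_
infixl 7 _*ʳ_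
infixl 6 _+ʳ_ _-ʳ_

_+ʳ_ : ℝ → ℝ → ℝ
x +ʳ y = mkℝ (λ n → seq x n ℚ.+ seq y n) c
  where
  c : ∀ ε → 0ℚ ℚ.< ε → ∃ λ N → ∀ m n → N ℕ.≤ m → N ℕ.≤ n →
      ℚ.∣ (seq x m ℚ.+ seq y m) ℚ.- (seq x n ℚ.+ seq y n) ∣ ℚ.≤ ε
  c ε ε>0 with cauchy x (½ ℚ.* ε) (half-pos ε>0) | cauchy y (½ ℚ.* ε) (half-pos ε>0)
  ... | N , cx | M , cy = N ℕ.⊔ M , λ m n m≥ n≥ → begin
      ℚ.∣ (seq x m ℚ.+ seq y m) ℚ.- (seq x n ℚ.+ seq y n) ∣
        ≡⟨ cong ℚ.∣_∣ (rearrange (seq x m) (seq y m) (seq x n) (seq y n)) ⟩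
      ℚ.∣ (seq x m ℚ.- seq x n) ℚ.+ (seq y m ℚ.- seq y n) ∣
        ≤⟨ ℚ.∣p+q∣≤∣p∣+∣q∣ (seq x m ℚ.- seq x n) (seq y m ℚ.- seq y n) ⟩
      ℚ.∣ seq x m ℚ.- seq x n ∣ ℚ.+ ℚ.∣ seq y m ℚ.- seq y n ∣
        ≤⟨ ℚ.+-mono-≤ (cx m n (ℕ.m⊔n≤o⇒m≤o N M m≥) (ℕ.m⊔n≤o⇒m≤o N M n≥))
                      (cy m n (ℕ.m⊔n≤o⇒n≤o N M m≥) (ℕ.m⊔n≤o⇒n≤o N M n≥)) ⟩
      ½ ℚ.* ε ℚ.+ ½ ℚ.* ε
        ≡⟨ halves ε ⟩
      ε ∎
    where
    open ℚ.≤-Reasoning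
    open +-*-Solver
    rearrange : ∀ a b c d → (a ℚ.+ b) ℚ.- (c ℚ.+ d) ≡ (a ℚ.- c) ℚ.+ (b ℚ.- d)
    rearrange = solve 4 (λ a b c d → (a :+ b) :- (c :+ d) := (a :- c) :+ (b :- d)) refl

private abstract
  *-rearrange : ∀ a b c d → a ℚ.* b ℚ.- c ℚ.* d ≡ a ℚ.* (b ℚ.- d) ℚ.+ (a ℚ.- c) ℚ.* d
  *-rearrange = solve 4 (λ a b c d →
    a :* b :- c :* d := a :* (b :- d) :+ (a :- c) :* d) refl
    where open +-*-Solver

  factor : ∀ a b e i → a ℚ.* (e ℚ.* i) ℚ.+ (e ℚ.* i) ℚ.* b ≡ e ℚ.* (i ℚ.* (a ℚ.+ b))
  factor = solve 4 (λ a b e i →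
    a :* (e :* i) :+ (e :* i) :* b := e :* (i :* (a :+ b))) refl
    where open +-*-Solver

  inverse : ∀ p → 0ℚ ℚ.< p → ∃ λ q → 0ℚ ℚ.< q × q ℚ.* p ≡ 1ℚ
  inverse p p>0 =
    (ℚ.1/ p) , ℚ.positive⁻¹ (ℚ.1/ p) {{ℚ.1/pos⇒pos p}} , ℚ.*-inverseˡ p
    where
    instance
      p⁺ : ℚ.Positive p
      p⁺ = ℚ.positive p>0
      p≢0 : ℚ.NonZero p
      p≢0 = ℚ.pos⇒nonZero p

  split-ε : ∀ {A B ε} → 0ℚ ℚ.< A → 0ℚ ℚ.< B → 0ℚ ℚ.< ε →
            ∃ λ δ → 0ℚ ℚ.< δ × A ℚ.* δ ℚ.+ δ ℚ.* B ≡ ε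
  split-ε {A} {B} {ε} A>0 B>0 ε>0 with inverse (A ℚ.+ B) (ℚ.+-mono-< A>0 B>0)
  ... | i , i>0 , i-inv = ε ℚ.* i , pos-* ε>0 i>0 ,
    trans (factor A B ε i) (trans (cong (ε ℚ.*_) i-inv) (ℚ.*-identityʳ ε))

  ∣*∣-mono : ∀ {p q r s} → ℚ.∣ p ∣ ℚ.≤ r → ℚ.∣ q ∣ ℚ.≤ s → 0ℚ ℚ.< r →
             ℚ.∣ p ℚ.* q ∣ ℚ.≤ r ℚ.* s
  ∣*∣-mono {p} {q} {r} {s} p≤r q≤s r>0 = begin
    ℚ.∣ p ℚ.* q ∣          ≡⟨ ℚ.∣p*q∣≡∣p∣*∣q∣ p q ⟩
    ℚ.∣ p ∣ ℚ.* ℚ.∣ q ∣    ≤⟨ ℚ.*-monoʳ-≤-nonNeg ℚ.∣ q ∣ {{ℚ.nonNegative (ℚ.0≤∣p∣ q)}} p≤r ⟩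
    r ℚ.* ℚ.∣ q ∣          ≤⟨ ℚ.*-monoˡ-≤-nonNeg r {{ℚ.nonNegative (ℚ.<⇒≤ r>0)}} q≤s ⟩
    r ℚ.* s                ∎
    where open ℚ.≤-Reasoning

  *-close : ∀ a b c d {A B δ ε} → 0ℚ ℚ.< A → 0ℚ ℚ.< δ → A ℚ.* δ ℚ.+ δ ℚ.* B ≡ ε →
            ℚ.∣ a ∣ ℚ.≤ A → ℚ.∣ d ∣ ℚ.≤ B →
            ℚ.∣ a ℚ.- c ∣ ℚ.≤ δ → ℚ.∣ b ℚ.- d ∣ ℚ.≤ δ →
            ℚ.∣ a ℚ.* b ℚ.- c ℚ.* d ∣ ℚ.≤ ε
  *-close a b c d {A} {B} {δ} {ε} A>0 δ>0 sum-δ a≤A d≤B ac bd = begin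
    ℚ.∣ a ℚ.* b ℚ.- c ℚ.* d ∣
      ≡⟨ cong ℚ.∣_∣ (*-rearrange a b c d) ⟩
    ℚ.∣ a ℚ.* (b ℚ.- d) ℚ.+ (a ℚ.- c) ℚ.* d ∣
      ≤⟨ ℚ.∣p+q∣≤∣p∣+∣q∣ (a ℚ.* (b ℚ.- d)) ((a ℚ.- c) ℚ.* d) ⟩
    ℚ.∣ a ℚ.* (b ℚ.- d) ∣ ℚ.+ ℚ.∣ (a ℚ.- c) ℚ.* d ∣
      ≤⟨ ℚ.+-mono-≤ (∣*∣-mono {a} {b ℚ.- d} a≤A bd A>0) (∣*∣-mono {a ℚ.- c} {d} ac d≤B δ>0) ⟩
    A ℚ.* δ ℚ.+ δ ℚ.* B
      ≡⟨ sum-δ ⟩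
    ε ∎
    where open ℚ.≤-Reasoning

_*ʳ_ : ℝ → ℝ → ℝ
x *ʳ y = mkℝ (λ n → seq x n ℚ.* seq y n) c
  where
  c : ∀ ε → 0ℚ ℚ.< ε → ∃ λ N → ∀ m n → N ℕ.≤ m → N ℕ.≤ n →
      ℚ.∣ seq x m ℚ.* seq y m ℚ.- seq x n ℚ.* seq y n ∣ ℚ.≤ ε
  c ε ε>0 with eventually-bounded x | eventually-bounded y
  ... | A , K , A>0 , x≤A | B , J , B>0 , y≤B with split-ε A>0 B>0 ε>0
  ... | δ , δ>0 , sum-δ with cauchy x δ δ>0 | cauchy y δ δ>0
  ... | N , cx | M , cy = (K ℕ.⊔ J) ℕ.⊔ (N ℕ.⊔ M) , λ m n m≥ n≥ →
    let m≥KJ = ℕ.m⊔n≤o⇒m≤o (K ℕ.⊔ J) (N ℕ.⊔ M) m≥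
        n≥KJ = ℕ.m⊔n≤o⇒m≤o (K ℕ.⊔ J) (N ℕ.⊔ M) n≥
        m≥NM = ℕ.m⊔n≤o⇒n≤o (K ℕ.⊔ J) (N ℕ.⊔ M) m≥
        n≥NM = ℕ.m⊔n≤o⇒n≤o (K ℕ.⊔ J) (N ℕ.⊔ M) n≥
    in *-close (seq x m) (seq y m) (seq x n) (seq y n) {A} {B} {δ} {ε} A>0 δ>0 sum-δ
         (x≤A m (ℕ.m⊔n≤o⇒m≤o K J m≥KJ))
         (y≤B n (ℕ.m⊔n≤o⇒n≤o K J n≥KJ))
         (cx m n (ℕ.m⊔n≤o⇒m≤o N M m≥NM) (ℕ.m⊔n≤o⇒m≤o N M n≥NM))
         (cy m n (ℕ.m⊔n≤o⇒n≤o N M m≥NM) (ℕ.m⊔n≤o⇒n≤o N M n≥NM))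

-ʳ_ : ℝ → ℝ
-ʳ x = fromℚ (ℚ.- 1ℚ) *ʳ x

_-ʳ_ : ℝ → ℝ → ℝ
x -ʳ y = x +ʳ -ʳ y

ℝ³ : Set
ℝ³ = Vector ℝ 3

infix  4 _≋_
infixr 7 _·_
infixl 6 _⊕_ _⊝_

_≋_ : ℝ³ → ℝ³ → Set
x ≋ y = ∀ j → x j ≈ y j

_⊕_ _⊝_ : ℝ³ → ℝ³ → ℝ³
_⊕_ = zipWith _+ʳ_
_⊝_ = zipWith _-ʳ_

_·_ : ℝ → ℝ³ → ℝ³
c · x = map (c *ʳ_) x

Σ³ : ℝ³ → ℝ
Σ³ x = x 0F +ʳ x 1F +ʳ x 2F

𝒟 : Pred ℝ³ 0ℓ
𝒟 x = Σ³ x ≈ 0ʳ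

π : ℝ³ → ℝ³
π x = x ⊝ (⅓ *ʳ Σ³ x) · (λ _ → 1ʳ)

private abstract
  collect : ∀ a b c m k u z →
    let d = m ℚ.* (k ℚ.* (a ℚ.+ b ℚ.+ c) ℚ.* u) in
    ((a ℚ.+ d) ℚ.+ (b ℚ.+ d) ℚ.+ (c ℚ.+ d)) ℚ.- z ≡
    ((a ℚ.+ b ℚ.+ c) ℚ.+ (m ℚ.* (k ℚ.+ k ℚ.+ k) ℚ.* u) ℚ.* (a ℚ.+ b ℚ.+ c)) ℚ.- z
  collect = solve 7 (λ a b c m k u z →
    let d = m :* (k :* (a :+ b :+ c) :* u) in
    ((a :+ d) :+ (b :+ d) :+ (c :+ d)) :- z :=
    ((a :+ b :+ c) :+ (m :* (k :+ k :+ k) :* u) :* (a :+ b :+ c)) :- z) refl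
    where open +-*-Solver

  cancel : ∀ t → (t ℚ.+ (ℚ.- 1ℚ) ℚ.* t) ℚ.- 0ℚ ≡ 0ℚ
  cancel t = trans (ℚ.+-identityʳ _)
    (trans (cong (t ℚ.+_) (trans (sym (ℚ.neg-distribˡ-* 1ℚ t)) (cong ℚ.-_ (ℚ.*-identityˡ t))))
           (ℚ.+-inverseʳ t))

  vanish : ∀ a b c →
    let d = (ℚ.- 1ℚ) ℚ.* ((1ℤ ℚ./ 3) ℚ.* (a ℚ.+ b ℚ.+ c) ℚ.* 1ℚ) in
    ((a ℚ.+ d) ℚ.+ (b ℚ.+ d) ℚ.+ (c ℚ.+ d)) ℚ.- 0ℚ ≡ 0ℚ
  vanish a b c = trans (collect a b c (ℚ.- 1ℚ) (1ℤ ℚ./ 3) 1ℚ 0ℚ) (cancel (a ℚ.+ b ℚ.+ c))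

-- Subsets of 𝒟 are represented as subsets of ℝ³.  Every one used below
-- lies in 𝒟, being built from linear combinations of points π x.
π∈𝒟 : ∀ x → π x ∈ 𝒟
π∈𝒟 x ε ε>0 = 0 , λ n _ →
  subst (λ q → ℚ.∣ q ∣ ℚ.≤ ε) (sym (vanish (seq (x 0F) n) (seq (x 1F) n) (seq (x 2F) n)))
        (ℚ.<⇒≤ ε>0)

Subset : Set₁
Subset = Pred ℝ³ 0ℓ

image : (ℝ³ → ℝ³) → Subset → Subset
image f σ y = ∃ λ x → x ∈ σ × y ≋ f x

segment : ℝ³ → ℝ³ → Subset
segment p q x = ∃ λ c → 0ʳ ≤ʳ c × c ≤ʳ 1ʳ × x ≋ p ⊕ c · (q ⊝ p)

parallelogram : ℝ³ → ℝ³ → Subset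
parallelogram p q x = ∃₂ λ α β →
  (0ʳ ≤ʳ α × α ≤ʳ 1ʳ) × (0ʳ ≤ʳ β × β ≤ʳ 1ʳ) × x ≋ α · p ⊕ β · q

-- An element of the lattice π(ℤ³) ≅ ℤ³/(1,1,1)ℤ is given by a representative
-- in ℤ³, up to _≈ᴸ_; the corresponding point of 𝒟 is ⟦ l ⟧.
L : Set
L = Vector ℤ 3

infix  4 _≈ᴸ_
infixr 7 _·ᴸ_
infixl 6 _+ᴸ_

_≈ᴸ_ : L → L → Set
l ≈ᴸ m = ∃ λ k → ∀ j → l j ≡ m j ℤ.+ k

0ᴸ : L
0ᴸ _ = 0ℤ

_+ᴸ_ : L → L → L
_+ᴸ_ = zipWith ℤ._+_

_·ᴸ_ : ℤ → L → L
k ·ᴸ l = map (k ℤ.*_) l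

h : Fin 3 → L
h i j = if does (i ≟ j) then 1ℤ else 0ℤ

⟦_⟧ : L → ℝ³
⟦ l ⟧ = π (map fromℤ l)

-- (l , i) stands for the edge (l , l + hᵢ).
Edge : Set
Edge = L × Fin 3

source target : Edge → L
source (l , i) = l
target (l , i) = l +ᴸ h i

edgeSegment : Edge → Subset
edgeSegment e = segment ⟦ source e ⟧ ⟦ target e ⟧

Piece : Set₁
Piece = Fin 3 × Subset

Tr : Subset → Pred Edge 0ℓ → Pred Piece 0ℓ
Tr P X (i , σ) = ∃ λ l →
  (l , i) ∈ X ×
  Satisfiable (edgeSegment (l , i) ∩ P) ×
  σ ≐ (edgeSegment (l , i) ∩ P)

-- The direction label is kept: a point symmetry reverses an edge but keeps
-- it in direction hᵢ.
act : ∀ {ℓ} → (ℝ³ → ℝ³) → Pred Piece ℓ → Pred Piece (lsuc 0ℓ ⊔ ℓ)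
act f S (i , τ) = ∃ λ σ → (i , σ) ∈ S × τ ≐ image f σ

module Christoffel (a : Vector ℕ 3) (a>0 : ∀ i → 0 ℕ.< a i) where

  s : ℕ
  s = a 0F ℕ.+ a 1F ℕ.+ a 2F

  instance
    s≢0 : ℕ.NonZero s
    s≢0 = ℕ.>-nonZero (ℕ.<-≤-trans (a>0 0F)
            (ℕ.≤-trans (ℕ.m≤m+n (a 0F) (a 1F)) (ℕ.m≤m+n (a 0F ℕ.+ a 1F) (a 2F))))

  -- Elements of ℤ/sℤ are represented by their residues in {0,…,s-1}.  The
  -- value does not depend on the representative of l, as (1,1,1) is sent to s.
  F′ : L → ℕ
  F′ l = (l 0F ℤ.* + a 0F ℤ.+ l 1F ℤ.* + a 1F ℤ.+ l 2F ℤ.* + a 2F) %ℕ s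

  Ker : Pred L 0ℓ
  Ker l = F′ l ≡ 0

  IsBasisOfKer : L → L → Set
  IsBasisOfKer v₁ v₂ =
    v₁ ∈ Ker × v₂ ∈ Ker ×
    (∀ l → l ∈ Ker → ∃₂ λ m n → l ≈ᴸ m ·ᴸ v₁ +ᴸ n ·ᴸ v₂) ×
    (∀ m n → m ·ᴸ v₁ +ᴸ n ·ᴸ v₂ ≈ᴸ 0ᴸ → m ≡ 0ℤ × n ≡ 0ℤ)

  I : Pred Edge 0ℓ
  I e = F′ (source e) ℕ.< F′ (target e)

  Q′ : Pred Edge 0ℓ
  Q′ e = F′ (source e) ≡ 0 ⊎ F′ (target e) ≡ 0

  flip : Pred Edge 0ℓ → Pred Edge 0ℓ
  flip X = (X ∖ Q′) ∪ (Q′ ∖ X)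

-- The point symmetry ρ sends the edge (l , l + hᵢ) to the edge whose source is
-- v₁ + v₂ - (l + hᵢ).  As v₁ and v₂ lie in the kernel, this negates residues
-- modulo s.  Negation reverses the order of the nonzero residues but keeps 0
-- fixed, so ρ turns the usual order 0 < 1 < … < s-1 into 1 < … < s-1 < 0.
-- Edges increasing for the latter are exactly those of flip I, and the edges
-- avoiding 0 are the same for both orders.  The second order is also the usual
-- one pulled back along subtraction of 1, so translating by any t of residue -1
-- carries flip I to I; such a t exists because the aᵢ are relatively prime.

module Submission where

open import Defs
open import Data.Nat as ℕ using (ℕ; zero; suc; _<_; z<s; s<s; s≤s⁻¹)
import Data.Nat.Properties as ℕ
import Data.Nat.Divisibility as ℕ
open import Data.Nat.GCD using (gcd; gcd-GCD; module Bézout)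
open import Data.Integer as ℤ using (ℤ; 1ℤ; +_)
import Data.Integer.Properties as ℤ
open import Data.Integer.DivMod using (_/ℕ_; n%ℕd<d; a≡a%ℕn+[a/ℕn]*n)
open import Data.Integer.Divisibility.Signed
  using (_∣_; divides; ∣⇒∣ᵤ; ∣m∣n⇒∣m+n; ∣m∣n⇒∣m-n; ∣-refl)
open import Data.Integer.Tactic.RingSolver using (solve-∀)
open import Data.Rational as ℚ using (ℚ; 0ℚ; 1ℚ)
import Data.Rational.Properties as ℚ
import Data.Rational.Unnormalised as ℚᵘ
import Data.Rational.Unnormalised.Properties as ℚᵘ
open import Data.Rational.Solver using (module +-*-Solver)
open import Data.Fin using (Fin)
open import Data.Fin.Patterns using (0F; 1F; 2F)
open import Data.Product using (∃; ∃₂; _×_; _,_; proj₁; proj₂)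
open import Data.Sum using (_⊎_; inj₁; inj₂)
open import Data.Vec.Functional using (Vector)
open import Level using (0ℓ)
open import Relation.Nullary using (contradiction)
open import Relation.Unary using (Pred; _∈_; _⊆_; _∩_; _∖_; _≐_)
open import Relation.Unary.Properties using (≐-sym; ≐-trans)
open import Relation.Binary.PropositionalEquality
  using (_≡_; _≢_; refl; sym; trans; cong; cong₂; subst; module ≡-Reasoning)

-- Termwise and limiting equality of points.

-ℚ1 : ℚ
-ℚ1 = ℚ.- 1ℚ

infix 4 _≗³_ _≅_

-- Termwise equality of the representing sequences: the affine identities
-- below hold exactly, not just up to _≋_.
record _≗³_ (x y : ℝ³) : Set where
  constructor termwise
  field
    at : ∀ j n → seq (x j) n ≡ seq (y j) n

open _≗³_

-- A copy of _≋_ whose arguments can be inferred.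
record _≅_ (x y : ℝ³) : Set where
  constructor ≋⇒≅
  field
    ≅⇒≋ : x ≋ y

open _≅_

≗-sym : ∀ {x y} → x ≗³ y → y ≗³ x
≗-sym e = termwise λ j n → sym (at e j n)

≗-trans : ∀ {x y z} → x ≗³ y → y ≗³ z → x ≗³ z
≗-trans e e′ = termwise λ j n → trans (at e j n) (at e′ j n)

≗⇒≅ : ∀ {x y} → x ≗³ y → x ≅ y
≗⇒≅ {x} {y} e = ≋⇒≅ λ j ε ε>0 → 0 , λ n _ →
  subst (ℚ._≤ ε) (sym (zero-distance j n)) (ℚ.<⇒≤ ε>0)
  where
  zero-distance : ∀ j n → ℚ.∣ seq (x j) n ℚ.- seq (y j) n ∣ ≡ 0ℚ
  zero-distance j n = trans (cong (λ q → ℚ.∣ q ℚ.- seq (y j) n ∣) (at e j n))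
                            (cong ℚ.∣_∣ (ℚ.+-inverseʳ (seq (y j) n)))

abstract
  ∣-∣-comm : ∀ p q → ℚ.∣ p ℚ.- q ∣ ≡ ℚ.∣ q ℚ.- p ∣
  ∣-∣-comm p q = trans (sym (ℚ.∣-p∣≡∣p∣ (p ℚ.- q))) (cong ℚ.∣_∣ (swap p q))
    where
    open +-*-Solver
    swap : ∀ p q → ℚ.- (p ℚ.- q) ≡ q ℚ.- p
    swap = solve 2 (λ p q → :- (p :- q) := q :- p) refl

  triangle : ∀ p q r {ε} → ℚ.∣ p ℚ.- q ∣ ℚ.≤ ℚ.½ ℚ.* ε → ℚ.∣ q ℚ.- r ∣ ℚ.≤ ℚ.½ ℚ.* ε →
             ℚ.∣ p ℚ.- r ∣ ℚ.≤ ε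
  triangle p q r {ε} pq qr = begin
    ℚ.∣ p ℚ.- r ∣                        ≡⟨ cong ℚ.∣_∣ (insert p q r) ⟩
    ℚ.∣ (p ℚ.- q) ℚ.+ (q ℚ.- r) ∣        ≤⟨ ℚ.∣p+q∣≤∣p∣+∣q∣ (p ℚ.- q) (q ℚ.- r) ⟩
    ℚ.∣ p ℚ.- q ∣ ℚ.+ ℚ.∣ q ℚ.- r ∣      ≤⟨ ℚ.+-mono-≤ pq qr ⟩
    ℚ.½ ℚ.* ε ℚ.+ ℚ.½ ℚ.* ε              ≡⟨ halves ε ⟩
    ε                                    ∎
    where
    open ℚ.≤-Reasoning
    open +-*-Solver
    insert : ∀ p q r → p ℚ.- r ≡ (p ℚ.- q) ℚ.+ (q ℚ.- r)
    insert = solve 3 (λ p q r → p :- r := (p :- q) :+ (q :- r)) refl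
    halves : ∀ ε → ℚ.½ ℚ.* ε ℚ.+ ℚ.½ ℚ.* ε ≡ ε
    halves = solve 1 (λ ε → con ℚ.½ :* ε :+ con ℚ.½ :* ε := ε) refl

≅-sym : ∀ {x y} → x ≅ y → y ≅ x
≅-sym {x} {y} (≋⇒≅ x≋y) = ≋⇒≅ λ j ε ε>0 → let (N , c) = x≋y j ε ε>0 in
  N , λ n N≤n → subst (ℚ._≤ ε) (∣-∣-comm (seq (x j) n) (seq (y j) n)) (c n N≤n)

≅-trans : ∀ {x y z} → x ≅ y → y ≅ z → x ≅ z
≅-trans {x} {y} {z} (≋⇒≅ x≋y) (≋⇒≅ y≋z) = ≋⇒≅ λ j ε ε>0 →
  let half>0 = subst (ℚ._< ℚ.½ ℚ.* ε) (ℚ.*-zeroʳ ℚ.½) (ℚ.*-monoʳ-<-pos ℚ.½ ε>0)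
      (N , c) = x≋y j (ℚ.½ ℚ.* ε) half>0
      (M , d) = y≋z j (ℚ.½ ℚ.* ε) half>0
  in N ℕ.⊔ M , λ n n≥ →
    triangle (seq (x j) n) (seq (y j) n) (seq (z j) n)
      (c n (ℕ.m⊔n≤o⇒m≤o N M n≥)) (d n (ℕ.m⊔n≤o⇒n≤o N M n≥))

-- Point symmetries and translations as affine isometries.

record IsAffineIsometry (f : ℝ³ → ℝ³) : Set where
  field
    slope     : ℚ
    offset    : Fin 3 → ℕ → ℚ
    ∣slope∣≡1 : ℚ.∣ slope ∣ ≡ 1ℚ
    affine    : ∀ x j n → seq (f x j) n ≡ slope ℚ.* seq (x j) n ℚ.+ offset j n

open IsAffineIsometry

abstract
  slope-out : ∀ a b p q → (a ℚ.* p ℚ.+ b) ℚ.- (a ℚ.* q ℚ.+ b) ≡ a ℚ.* (p ℚ.- q)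
  slope-out = solve 4 (λ a b p q →
    (a :* p :+ b) :- (a :* q :+ b) := a :* (p :- q)) refl
    where open +-*-Solver

  affine-segment : ∀ a b p q c →
    a ℚ.* (p ℚ.+ c ℚ.* (q ℚ.+ -ℚ1 ℚ.* p)) ℚ.+ b ≡
    (a ℚ.* p ℚ.+ b) ℚ.+ c ℚ.* ((a ℚ.* q ℚ.+ b) ℚ.+ -ℚ1 ℚ.* (a ℚ.* p ℚ.+ b))
  affine-segment = solve 5 (λ a b p q c →
    a :* (p :+ c :* (q :+ con -ℚ1 :* p)) :+ b :=
    (a :* p :+ b) :+ c :* ((a :* q :+ b) :+ con -ℚ1 :* (a :* p :+ b))) refl
    where open +-*-Solver

  reverse-segment : ∀ p q c →
    p ℚ.+ c ℚ.* (q ℚ.+ -ℚ1 ℚ.* p) ≡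
    q ℚ.+ (1ℚ ℚ.+ -ℚ1 ℚ.* c) ℚ.* (p ℚ.+ -ℚ1 ℚ.* q)
  reverse-segment = solve 3 (λ p q c →
    p :+ c :* (q :+ con -ℚ1 :* p) :=
    q :+ (con 1ℚ :+ con -ℚ1 :* c) :* (p :+ con -ℚ1 :* q)) refl
    where open +-*-Solver

  reflect-parallelogram : ∀ p q α β →
    (p ℚ.+ q) ℚ.+ -ℚ1 ℚ.* (α ℚ.* p ℚ.+ β ℚ.* q) ≡
    (1ℚ ℚ.+ -ℚ1 ℚ.* α) ℚ.* p ℚ.+ (1ℚ ℚ.+ -ℚ1 ℚ.* β) ℚ.* q
  reflect-parallelogram = solve 4 (λ p q α β →
    (p :+ q) :+ con -ℚ1 :* (α :* p :+ β :* q) :=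
    (con 1ℚ :+ con -ℚ1 :* α) :* p :+ (con 1ℚ :+ con -ℚ1 :* β) :* q) refl
    where open +-*-Solver

  reflect-involutive : ∀ w x → x ≡ w ℚ.+ -ℚ1 ℚ.* (w ℚ.+ -ℚ1 ℚ.* x)
  reflect-involutive = solve 2 (λ w x →
    x := w :+ con -ℚ1 :* (w :+ con -ℚ1 :* x)) refl
    where open +-*-Solver

  +-then-− : ∀ x t → x ≡ (x ℚ.+ t) ℚ.+ -ℚ1 ℚ.* t
  +-then-− = solve 2 (λ x t → x := (x :+ t) :+ con -ℚ1 :* t) refl
    where open +-*-Solver

-- The offsets cancel and the slope has absolute value 1, so distances between corresponding terms
-- are kept exactly and the same index bound serves.
isometry-cong : ∀ {f x y} → IsAffineIsometry f → x ≅ y → f x ≅ f y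
isometry-cong {f} {x} {y} F (≋⇒≅ x≋y) = ≋⇒≅ λ j ε ε>0 → let (N , c) = x≋y j ε ε>0 in
  N , λ n N≤n → subst (ℚ._≤ ε) (sym (distance j n)) (c n N≤n)
  where
  open ≡-Reasoning
  distance : ∀ j n → ℚ.∣ seq (f x j) n ℚ.- seq (f y j) n ∣ ≡ ℚ.∣ seq (x j) n ℚ.- seq (y j) n ∣
  distance j n = begin
    ℚ.∣ seq (f x j) n ℚ.- seq (f y j) n ∣
      ≡⟨ cong ℚ.∣_∣ (trans (cong₂ ℚ._-_ (affine F x j n) (affine F y j n))
           (slope-out (slope F) (offset F j n) (seq (x j) n) (seq (y j) n))) ⟩
    ℚ.∣ slope F ℚ.* (seq (x j) n ℚ.- seq (y j) n) ∣
      ≡⟨ ℚ.∣p*q∣≡∣p∣*∣q∣ (slope F) _ ⟩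
    ℚ.∣ slope F ∣ ℚ.* ℚ.∣ seq (x j) n ℚ.- seq (y j) n ∣
      ≡⟨ cong (ℚ._* _) (∣slope∣≡1 F) ⟩
    1ℚ ℚ.* ℚ.∣ seq (x j) n ℚ.- seq (y j) n ∣
      ≡⟨ ℚ.*-identityˡ _ ⟩
    ℚ.∣ seq (x j) n ℚ.- seq (y j) n ∣ ∎

reflection-isometry : ∀ w → IsAffineIsometry (w ⊝_)
reflection-isometry w = record
  { slope = -ℚ1 ; offset = λ j n → seq (w j) n ; ∣slope∣≡1 = refl
  ; affine = λ x j n → ℚ.+-comm (seq (w j) n) _ }

⊕-isometry : ∀ t → IsAffineIsometry (_⊕ t)
⊕-isometry t = record
  { slope = 1ℚ ; offset = λ j n → seq (t j) n ; ∣slope∣≡1 = refl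
  ; affine = λ x j n → cong (ℚ._+ seq (t j) n) (sym (ℚ.*-identityˡ (seq (x j) n))) }

⊝-isometry : ∀ t → IsAffineIsometry (_⊝ t)
⊝-isometry t = record
  { slope = 1ℚ ; offset = λ j n → -ℚ1 ℚ.* seq (t j) n ; ∣slope∣≡1 = refl
  ; affine = λ x j n → cong (ℚ._+ -ℚ1 ℚ.* seq (t j) n) (sym (ℚ.*-identityˡ (seq (x j) n))) }

⊝-involutive : ∀ w x → x ≗³ w ⊝ (w ⊝ x)
⊝-involutive w x = termwise λ j n → reflect-involutive (seq (w j) n) (seq (x j) n)

⊕-⊝-cancel : ∀ t x → x ≗³ (x ⊕ t) ⊝ t
⊕-⊝-cancel t x = termwise λ j n → +-then-− (seq (x j) n) (seq (t j) n)

-- Segments and parallelograms under affine maps.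

Respects≅ : Subset → Set
Respects≅ S = ∀ {x y} → x ≅ y → x ∈ S → y ∈ S

segment-resp : ∀ p q → Respects≅ (segment p q)
segment-resp p q {x} x≅y (c , 0≤c , c≤1 , e) =
  c , 0≤c , c≤1 , ≅⇒≋ (≅-trans (≅-sym x≅y) (≋⇒≅ {x} {p ⊕ c · (q ⊝ p)} e))

parallelogram-resp : ∀ p q → Respects≅ (parallelogram p q)
parallelogram-resp p q {x} x≅y (α , β , bα , bβ , e) =
  α , β , bα , bβ , ≅⇒≋ (≅-trans (≅-sym x≅y) (≋⇒≅ {x} {α · p ⊕ β · q} e))

0≤1-c : ∀ {c} → c ≤ʳ 1ʳ → 0ʳ ≤ʳ 1ʳ -ʳ c
0≤1-c {c} c≤1 ε ε>0 with c≤1 ε ε>0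
... | N , b = N , λ n N≤n → begin
  0ℚ                                          ≡⟨ ℚ.+-inverseʳ (seq c n) ⟨
  seq c n ℚ.- seq c n                         ≤⟨ ℚ.+-monoˡ-≤ (ℚ.- seq c n) (b n N≤n) ⟩
  (1ℚ ℚ.+ ε) ℚ.- seq c n                      ≡⟨ rearrange ε (seq c n) ⟩
  (1ℚ ℚ.+ -ℚ1 ℚ.* seq c n) ℚ.+ ε              ∎
  where
  open ℚ.≤-Reasoning
  open +-*-Solver
  rearrange : ∀ ε c → (1ℚ ℚ.+ ε) ℚ.- c ≡ (1ℚ ℚ.+ -ℚ1 ℚ.* c) ℚ.+ ε
  rearrange = solve 2 (λ ε c → (con 1ℚ :+ ε) :- c := (con 1ℚ :+ con -ℚ1 :* c) :+ ε) refl

1-c≤1 : ∀ {c} → 0ʳ ≤ʳ c → 1ʳ -ʳ c ≤ʳ 1ʳ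
1-c≤1 {c} 0≤c ε ε>0 with 0≤c ε ε>0
... | N , b = N , λ n N≤n → begin
  1ℚ ℚ.+ -ℚ1 ℚ.* seq c n                                 ≡⟨ ℚ.+-identityʳ _ ⟨
  (1ℚ ℚ.+ -ℚ1 ℚ.* seq c n) ℚ.+ 0ℚ                        ≤⟨ ℚ.+-monoʳ-≤ (1ℚ ℚ.+ -ℚ1 ℚ.* seq c n) (b n N≤n) ⟩
  (1ℚ ℚ.+ -ℚ1 ℚ.* seq c n) ℚ.+ (seq c n ℚ.+ ε)           ≡⟨ rearrange ε (seq c n) ⟩
  1ℚ ℚ.+ ε                                               ∎
  where
  open ℚ.≤-Reasoning
  open +-*-Solver
  rearrange : ∀ ε c → (1ℚ ℚ.+ -ℚ1 ℚ.* c) ℚ.+ (c ℚ.+ ε) ≡ 1ℚ ℚ.+ ε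
  rearrange = solve 2 (λ ε c → (con 1ℚ :+ con -ℚ1 :* c) :+ (c :+ ε) := con 1ℚ :+ ε) refl

segment-reverse : ∀ p q x → x ∈ segment p q → x ∈ segment q p
segment-reverse p q x (c , 0≤c , c≤1 , e) =
  1ʳ -ʳ c , 0≤1-c {c} c≤1 , 1-c≤1 {c} 0≤c ,
  ≅⇒≋ (≅-trans (≋⇒≅ {x} {p ⊕ c · (q ⊝ p)} e)
    (≗⇒≅ {y = q ⊕ (1ʳ -ʳ c) · (p ⊝ q)} (termwise λ j n →
      reverse-segment (seq (p j) n) (seq (q j) n) (seq c n))))

-- An affine map keeps the parameter `c`. The new endpoints are free up to `_≗³_`, so that lattice
-- points can be supplied in place of the images of `p` and `q`.
segment-image : ∀ {f} p q {p′ q′} → IsAffineIsometry f → p′ ≗³ f p → q′ ≗³ f q →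
                ∀ x → x ∈ segment p q → f x ∈ segment p′ q′
segment-image {f} p q {p′} {q′} F p′≗ q′≗ x (c , 0≤c , c≤1 , e) =
  c , 0≤c , c≤1 , 
  ≅⇒≋ (≅-trans (isometry-cong F (≋⇒≅ {x} {p ⊕ c · (q ⊝ p)} e))
    (≗⇒≅ {y = p′ ⊕ c · (q′ ⊝ p′)} (termwise on-terms)))
  where
  open ≡-Reasoning
  on-terms : ∀ j n → seq (f (p ⊕ c · (q ⊝ p)) j) n ≡ seq ((p′ ⊕ c · (q′ ⊝ p′)) j) n
  on-terms j n = begin
    seq (f (p ⊕ c · (q ⊝ p)) j) n
      ≡⟨ affine F (p ⊕ c · (q ⊝ p)) j n ⟩
    slope F ℚ.* seq ((p ⊕ c · (q ⊝ p)) j) n ℚ.+ offset F j n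
      ≡⟨ affine-segment (slope F) (offset F j n) (seq (p j) n) (seq (q j) n) (seq c n) ⟩
    _ ≡⟨ cong₂ (λ a b → a ℚ.+ seq c n ℚ.* (b ℚ.+ -ℚ1 ℚ.* a))
           (trans (at p′≗ j n) (affine F p j n)) (trans (at q′≗ j n) (affine F q j n)) ⟨
    seq ((p′ ⊕ c · (q′ ⊝ p′)) j) n ∎

-- The symmetry replaces the coordinates `α`, `β` by `1 - α`, `1 - β`, which again lie between 0 and
-- 1.
parallelogram-symmetric : ∀ p q x → x ∈ parallelogram p q → (p ⊕ q) ⊝ x ∈ parallelogram p q
parallelogram-symmetric p q x (α , β , (0≤α , α≤1) , (0≤β , β≤1) , e) =
  1ʳ -ʳ α , 1ʳ -ʳ β ,
  (0≤1-c {α} α≤1 , 1-c≤1 {α} 0≤α) , (0≤1-c {β} β≤1 , 1-c≤1 {β} 0≤β) ,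
  ≅⇒≋ (≅-trans (isometry-cong (reflection-isometry (p ⊕ q)) (≋⇒≅ {x} {α · p ⊕ β · q} e))
    (≗⇒≅ {y = (1ʳ -ʳ α) · p ⊕ (1ʳ -ʳ β) · q} (termwise λ j n →
      reflect-parallelogram (seq (p j) n) (seq (q j) n) (seq α n) (seq β n))))

-- Transport of traces.

Carries : (f g : ℝ³ → ℝ³) → Subset → Subset → Set
Carries f g S S′ = (∀ x → x ∈ S → f x ∈ S′) × (∀ y → y ∈ S′ → g y ∈ S)

edgeSegment-resp : ∀ e → Respects≅ (edgeSegment e)
edgeSegment-resp e = segment-resp ⟦ source e ⟧ ⟦ target e ⟧

-- If `f` carries both the segment of an edge and `P`, with `g` leading back, then it maps their
-- intersection onto that of the image edge with `P′`: a point `y` of the latter is `f (g y)`. `P′`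
-- has to respect `_≅_` because `image f` contains every point equal to a value of `f` in the limit
-- only.
act-Tr : ∀ {f g P P′} {X Y : Pred Edge 0ℓ} →
  (∀ y → y ≗³ f (g y)) → Respects≅ P′ → Carries f g P P′ →
  (∀ l i → (l , i) ∈ X → ∃ λ l′ → (l′ , i) ∈ Y ×
    Carries f g (edgeSegment (l , i)) (edgeSegment (l′ , i))) →
  (∀ l′ i → (l′ , i) ∈ Y → ∃ λ l → (l , i) ∈ X ×
    Carries f g (edgeSegment (l , i)) (edgeSegment (l′ , i))) →
  act f (Tr P X) ≐ Tr P′ Y
act-Tr {f} {g} {P} {P′} {X} {Y} fg resp (P→ , ←P) X→Y Y→X = to , from
  where
  to : act f (Tr P X) ⊆ Tr P′ Y
  to {i , τ} (σ , (l , Xe , (x , xe , xP) , σ⊆ , ⊆σ) , τ⊆ , ⊆τ) =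
    let (l′ , Ye , e→ , ←e) = X→Y l i Xe in l′ , Ye , (f x , e→ x xe , P→ x xP) ,
    (λ {y} y∈τ → let (z , z∈σ , y≋fz) = τ⊆ y∈τ
                     (ze , zP) = σ⊆ {z} z∈σ
                     fz≅y = ≅-sym (≋⇒≅ {y} {f z} y≋fz) in
       edgeSegment-resp (l′ , i) fz≅y (e→ z ze) , resp fz≅y (P→ z zP)) ,
    (λ {y} (ye , yP) → ⊆τ (g y , ⊆σ (←e y ye , ←P y yP) , ≅⇒≋ (≗⇒≅ (fg y))))

  from : Tr P′ Y ⊆ act f (Tr P X)
  from {i , τ} (l′ , Ye , (y , ye , yP) , τ⊆ , ⊆τ) =
    let (l , Xe , e→ , ←e) = Y→X l′ i Ye in (edgeSegment (l , i) ∩ P) ,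
    (l , Xe , (g y , ←e y ye , ←P y yP) , (λ z → z) , (λ z → z)) ,
    (λ {z} z∈τ → let (ze , zP) = τ⊆ z∈τ in
       g z , (←e z ze , ←P z zP) , ≅⇒≋ (≗⇒≅ (fg z))) ,
    (λ {y} (z , (ze , zP) , y≋fz) → let fz≅y = ≅-sym (≋⇒≅ {y} {f z} y≋fz) in
       ⊆τ (edgeSegment-resp (l′ , i) fz≅y (e→ z ze) , resp fz≅y (P→ z zP)))

-- Lattice points, reversed edges and translated edges.

abstract
  -- Division normalises its result and is stuck on variables; among unnormalised fractions the
  -- claim is cross multiplication.
  /1-+ : ∀ m n → (m ℤ.+ n) ℚ./ 1 ≡ m ℚ./ 1 ℚ.+ n ℚ./ 1
  /1-+ m n = ℚ.toℚᵘ-injective (begin-equality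
    ℚ.toℚᵘ ((m ℤ.+ n) ℚ./ 1)
      ≃⟨ ℚ.toℚᵘ-fromℚᵘ (ℚᵘ.mkℚᵘ (m ℤ.+ n) 0) ⟩
    ℚᵘ.mkℚᵘ (m ℤ.+ n) 0
      ≃⟨ ℚᵘ.*≡* (denominators m n) ⟩
    ℚᵘ.mkℚᵘ m 0 ℚᵘ.+ ℚᵘ.mkℚᵘ n 0
      ≃⟨ ℚᵘ.+-cong (ℚ.toℚᵘ-fromℚᵘ (ℚᵘ.mkℚᵘ m 0)) (ℚ.toℚᵘ-fromℚᵘ (ℚᵘ.mkℚᵘ n 0)) ⟨
    ℚ.toℚᵘ (m ℚ./ 1) ℚᵘ.+ ℚ.toℚᵘ (n ℚ./ 1)
      ≃⟨ ℚ.toℚᵘ-homo-+ (m ℚ./ 1) (n ℚ./ 1) ⟨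
    ℚ.toℚᵘ (m ℚ./ 1 ℚ.+ n ℚ./ 1) ∎)
    where
    open ℚᵘ.≤-Reasoning
    denominators : ∀ m n → (m ℤ.+ n) ℤ.* 1ℤ ≡ (m ℤ.* 1ℤ ℤ.+ n ℤ.* 1ℤ) ℤ.* 1ℤ
    denominators = solve-∀

  -- Additivity of one coordinate of `π`, unfolded, with `k` standing for one third.
  projection-+ : ∀ a b x y z x′ y′ z′ k →
    (a ℚ.+ b) ℚ.+ -ℚ1 ℚ.* (k ℚ.* ((x ℚ.+ x′) ℚ.+ (y ℚ.+ y′) ℚ.+ (z ℚ.+ z′)) ℚ.* 1ℚ) ≡
    (a ℚ.+ -ℚ1 ℚ.* (k ℚ.* (x ℚ.+ y ℚ.+ z) ℚ.* 1ℚ)) ℚ.+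
    (b ℚ.+ -ℚ1 ℚ.* (k ℚ.* (x′ ℚ.+ y′ ℚ.+ z′) ℚ.* 1ℚ))
  projection-+ = solve 9 (λ a b x y z x′ y′ z′ k →
    (a :+ b) :+ con -ℚ1 :* (k :* ((x :+ x′) :+ (y :+ y′) :+ (z :+ z′)) :* con 1ℚ) :=
    (a :+ con -ℚ1 :* (k :* (x :+ y :+ z) :* con 1ℚ)) :+
    (b :+ con -ℚ1 :* (k :* (x′ :+ y′ :+ z′) :* con 1ℚ))) refl
    where open +-*-Solver

-- Lattice vectors are functions, so the sum `k` is given by a pointwise equation; this lets one
-- lemma serve every way in which a sum arises.
⟦⟧-+ : ∀ l m k → (∀ j → k j ≡ l j ℤ.+ m j) → ⟦ k ⟧ ≗³ ⟦ l ⟧ ⊕ ⟦ m ⟧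
⟦⟧-+ l m k k≡ = termwise λ j n →
  trans (formula (cast j) (cast 0F) (cast 1F) (cast 2F))
        (projection-+ (c l j) (c m j) (c l 0F) (c l 1F) (c l 2F)
                      (c m 0F) (c m 1F) (c m 2F) (1ℤ ℚ./ 3))
  where
  c : L → Fin 3 → ℚ
  c l i = l i ℚ./ 1

  cast : ∀ i → c k i ≡ c l i ℚ.+ c m i
  cast i = trans (cong (ℚ._/ 1) (k≡ i)) (/1-+ (l i) (m i))

  formula : ∀ {a a′ x x′ y y′ z z′} → a ≡ a′ → x ≡ x′ → y ≡ y′ → z ≡ z′ →
    a ℚ.+ -ℚ1 ℚ.* ((1ℤ ℚ./ 3) ℚ.* (x ℚ.+ y ℚ.+ z) ℚ.* 1ℚ) ≡
    a′ ℚ.+ -ℚ1 ℚ.* ((1ℤ ℚ./ 3) ℚ.* (x′ ℚ.+ y′ ℚ.+ z′) ℚ.* 1ℚ)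
  formula refl refl refl refl = refl

⊕⇒⊝ : ∀ x y z → x ≗³ y ⊕ z → y ≗³ x ⊝ z
⊕⇒⊝ x y z e = ≗-trans (⊕-⊝-cancel z y) (termwise λ j n →
  cong (ℚ._+ -ℚ1 ℚ.* seq (z j) n) (sym (at e j n)))

-- For `w = v₁ + v₂` the symmetry `ρ` exchanges the edges in direction `i` from `l` and from `l′`.
-- Writing this as a sum makes it symmetric in `l` and `l′` and ready for additive maps.
Reversed : L → Fin 3 → L → L → Set
Reversed w i l l′ = ∀ j → w j ≡ target (l , i) j ℤ.+ l′ j

Translated : L → L → L → Set
Translated t l l′ = ∀ j → l j ≡ l′ j ℤ.+ t j

abstract
  exchange : ∀ l h l′ → (l ℤ.+ h) ℤ.+ l′ ≡ (l′ ℤ.+ h) ℤ.+ l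
  exchange = solve-∀

  complement : ∀ w l → w ≡ l ℤ.+ (w ℤ.- l)
  complement = solve-∀

  undo : ∀ l t → l ≡ (l ℤ.- t) ℤ.+ t
  undo = solve-∀

  target-shift : ∀ l t h → (l ℤ.+ t) ℤ.+ h ≡ (l ℤ.+ h) ℤ.+ t
  target-shift = solve-∀

reversed-sym : ∀ w i l l′ → Reversed w i l l′ → Reversed w i l′ l
reversed-sym w i l l′ r j = trans (r j) (exchange (l j) (h i j) (l′ j))

reversed-exists : ∀ w i l → ∃ (Reversed w i l)
reversed-exists w i l =
  (λ j → w j ℤ.- target (l , i) j) , λ j → complement (w j) (target (l , i) j)

translated-target : ∀ t l l′ i → Translated t l l′ →
                    Translated t (target (l , i)) (target (l′ , i))
translated-target t l l′ i r j =
  trans (cong (ℤ._+ h i j) (r j)) (target-shift (l′ j) (t j) (h i j))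

⟦⟧-reversed : ∀ {v₁ v₂} m m′ → (∀ j → (v₁ +ᴸ v₂) j ≡ m j ℤ.+ m′ j) →
              ⟦ m ⟧ ≗³ (⟦ v₁ ⟧ ⊕ ⟦ v₂ ⟧) ⊝ ⟦ m′ ⟧
⟦⟧-reversed {v₁} {v₂} m m′ e = ⊕⇒⊝ (⟦ v₁ ⟧ ⊕ ⟦ v₂ ⟧) ⟦ m ⟧ ⟦ m′ ⟧
  (≗-trans (≗-sym (⟦⟧-+ v₁ v₂ (v₁ +ᴸ v₂) λ _ → refl)) (⟦⟧-+ m m′ (v₁ +ᴸ v₂) e))

reversed-segment : ∀ v₁ v₂ i l l′ → Reversed (v₁ +ᴸ v₂) i l l′ → ∀ x →
  x ∈ edgeSegment (l , i) → (⟦ v₁ ⟧ ⊕ ⟦ v₂ ⟧) ⊝ x ∈ edgeSegment (l′ , i)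
reversed-segment v₁ v₂ i l l′ r x x∈ =
  -- The symmetry takes the source of one edge to the target of the other, so the image segment
  -- arrives with its ends exchanged.
  segment-reverse ⟦ target (l′ , i) ⟧ ⟦ l′ ⟧ ((⟦ v₁ ⟧ ⊕ ⟦ v₂ ⟧) ⊝ x)
    (segment-image ⟦ l ⟧ ⟦ target (l , i) ⟧ (reflection-isometry (⟦ v₁ ⟧ ⊕ ⟦ v₂ ⟧))
      (⟦⟧-reversed {v₁} {v₂} (target (l′ , i)) l (reversed-sym (v₁ +ᴸ v₂) i l l′ r))
      (⟦⟧-reversed {v₁} {v₂} l′ (target (l , i)) λ j →
        trans (r j) (ℤ.+-comm (target (l , i) j) (l′ j)))
      x x∈)

reversed-carries : ∀ v₁ v₂ i l l′ → Reversed (v₁ +ᴸ v₂) i l l′ →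
  let ρ = λ x → (⟦ v₁ ⟧ ⊕ ⟦ v₂ ⟧) ⊝ x in
  Carries ρ ρ (edgeSegment (l , i)) (edgeSegment (l′ , i))
reversed-carries v₁ v₂ i l l′ r =
  reversed-segment v₁ v₂ i l l′ r ,
  reversed-segment v₁ v₂ i l′ l (reversed-sym (v₁ +ᴸ v₂) i l l′ r)

translated-carries : ∀ t l l′ i → Translated t l l′ →
  Carries (_⊝ ⟦ t ⟧) (_⊕ ⟦ t ⟧) (edgeSegment (l , i)) (edgeSegment (l′ , i))
translated-carries t l l′ i r =
  segment-image ⟦ l ⟧ ⟦ target (l , i) ⟧ (⊝-isometry ⟦ t ⟧)
    (⊕⇒⊝ ⟦ l ⟧ ⟦ l′ ⟧ ⟦ t ⟧ sources)
    (⊕⇒⊝ ⟦ target (l , i) ⟧ ⟦ target (l′ , i) ⟧ ⟦ t ⟧ targets) ,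
  segment-image ⟦ l′ ⟧ ⟦ target (l′ , i) ⟧ (⊕-isometry ⟦ t ⟧) sources targets
  where
  sources : ⟦ l ⟧ ≗³ ⟦ l′ ⟧ ⊕ ⟦ t ⟧
  sources = ⟦⟧-+ l′ t l r
  targets : ⟦ target (l , i) ⟧ ≗³ ⟦ target (l′ , i) ⟧ ⊕ ⟦ t ⟧
  targets = ⟦⟧-+ (target (l′ , i)) t (target (l , i)) (translated-target t l l′ i r)

translate-carries : ∀ t P → Respects≅ P → Carries (_⊝ t) (_⊕ t) (image (_⊕ t) P) P
translate-carries t P resp =
  (λ x (p , p∈P , x≋) → resp {p} {x ⊝ t}
    (≅-trans (≗⇒≅ (⊕-⊝-cancel t p))
      (isometry-cong {x = p ⊕ t} {y = x} (⊝-isometry t) (≅-sym (≋⇒≅ {x} {p ⊕ t} x≋))))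
    p∈P) ,
  (λ y y∈P → y , y∈P , ≅⇒≋ {y ⊕ t} {y ⊕ t} (≗⇒≅ (termwise λ _ _ → refl)))

-- Bézout coefficients and arithmetic of residues.

ℤ-bézout : ∀ m n → ∃₂ λ x y → x ℤ.* + m ℤ.+ y ℤ.* + n ≡ + gcd m n
ℤ-bézout m n with Bézout.identity (gcd-GCD m n)
-- Over the naturals the identity has two forms, according to which term is moved across; over the
-- integers that term gets a negative coefficient.
... | Bézout.+- x y eq = + x , ℤ.- + y , (begin
  + x ℤ.* + m ℤ.+ ℤ.- + y ℤ.* + n                 ≡⟨ cong (ℤ._+ ℤ.- + y ℤ.* + n) (ℤ.pos-* x m) ⟨
  + (x ℕ.* m) ℤ.+ ℤ.- + y ℤ.* + n                 ≡⟨ cong (λ k → + k ℤ.+ ℤ.- + y ℤ.* + n) eq ⟨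
  + (gcd m n ℕ.+ y ℕ.* n) ℤ.+ ℤ.- + y ℤ.* + n     ≡⟨ cong (λ k → + gcd m n ℤ.+ k ℤ.+ ℤ.- + y ℤ.* + n) (ℤ.pos-* y n) ⟩
  + gcd m n ℤ.+ + y ℤ.* + n ℤ.+ ℤ.- + y ℤ.* + n   ≡⟨ cancel (+ gcd m n) (+ y) (+ n) ⟩
  + gcd m n                                       ∎)
  where
  open ≡-Reasoning
  cancel : ∀ g y n → g ℤ.+ y ℤ.* n ℤ.+ ℤ.- y ℤ.* n ≡ g
  cancel = solve-∀
... | Bézout.-+ x y eq = ℤ.- + x , + y , (begin
  ℤ.- + x ℤ.* + m ℤ.+ + y ℤ.* + n                   ≡⟨ cong (λ k → ℤ.- + x ℤ.* + m ℤ.+ k) (ℤ.pos-* y n) ⟨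
  ℤ.- + x ℤ.* + m ℤ.+ + (y ℕ.* n)                   ≡⟨ cong (λ k → ℤ.- + x ℤ.* + m ℤ.+ + k) eq ⟨
  ℤ.- + x ℤ.* + m ℤ.+ + (gcd m n ℕ.+ x ℕ.* m)       ≡⟨ cong (λ k → ℤ.- + x ℤ.* + m ℤ.+ (+ gcd m n ℤ.+ k)) (ℤ.pos-* x m) ⟩
  ℤ.- + x ℤ.* + m ℤ.+ (+ gcd m n ℤ.+ + x ℤ.* + m)   ≡⟨ cancel (+ gcd m n) (+ x) (+ m) ⟩
  + gcd m n                                         ∎)
  where
  open ≡-Reasoning
  cancel : ∀ g x m → ℤ.- x ℤ.* m ℤ.+ (g ℤ.+ x ℤ.* m) ≡ g
  cancel = solve-∀

-- The difference is a multiple of `d` of absolute value below `d`, hence zero.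
residues-≡ : ∀ {d u v} → u < d → v < d → + d ∣ + u ℤ.- + v → u ≡ v
residues-≡ {d} {u} {v} u<d v<d d∣ =
  ℤ.+-injective (ℤ.i-j≡0⇒i≡j (+ u) (+ v) (ℤ.∣i∣≡0⇒i≡0 (small (∣⇒∣ᵤ d∣) ∣u-v∣<d)))
  where
  small : ∀ {n} → d ℕ.∣ n → n < d → n ≡ 0
  small {zero}  _   _   = refl
  small {suc n} d∣n n<d = contradiction d∣n (ℕ.>⇒∤ n<d)

  ∣u-v∣<d : ℤ.∣ + u ℤ.- + v ∣ < d
  ∣u-v∣<d = ℕ.≤-<-trans
    (subst (λ i → ℤ.∣ i ∣ ℕ.≤ u ℕ.⊔ v) (sym (ℤ.m-n≡m⊖n u v)) (ℤ.∣m⊝n∣≤m⊔n u v))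
    (ℕ.⊔-lub u<d v<d)

-- Negation modulo `d`, spelled out on the representatives below `d`.
Opposite : ℕ → ℕ → ℕ → Set
Opposite d u v = (u ≡ 0 × v ≡ 0) ⊎ (0 < u × 0 < v × u ℕ.+ v ≡ d)

opposite-sym : ∀ {d u v} → Opposite d u v → Opposite d v u
opposite-sym         (inj₁ (u≡0 , v≡0))       = inj₁ (v≡0 , u≡0)
opposite-sym {u = u} (inj₂ (u>0 , v>0 , sum)) = inj₂ (v>0 , u>0 , trans (ℕ.+-comm _ u) sum)

-- Since `u + v < d + d`, the quotient is 0 or 1. Quotient 1 excludes a zero residue, as the other
-- one would then equal `d`.
∣-sum⇒opposite : ∀ {d u v} → u < d → v < d → d ℕ.∣ u ℕ.+ v → Opposite d u v
∣-sum⇒opposite {d} {u} {v} u<d v<d (ℕ.divides 0 sum) =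
  inj₁ (ℕ.m+n≡0⇒m≡0 u sum , ℕ.m+n≡0⇒n≡0 u sum)
∣-sum⇒opposite {d} {u} {v} u<d v<d (ℕ.divides 1 sum) =
  inj₂ (ℕ.n≢0⇒n>0 u≢0 , ℕ.n≢0⇒n>0 v≢0 , u+v≡d)
  where
  u+v≡d : u ℕ.+ v ≡ d
  u+v≡d = trans sum (ℕ.+-identityʳ d)
  u≢0 : u ≢ 0
  u≢0 refl = ℕ.<-irrefl u+v≡d v<d
  v≢0 : v ≢ 0
  v≢0 refl = ℕ.<-irrefl (trans (sym (ℕ.+-identityʳ u)) u+v≡d) u<d
∣-sum⇒opposite {d} {u} {v} u<d v<d (ℕ.divides (suc (suc q)) sum) =
  contradiction (ℕ.+-mono-< u<d v<d) (ℕ.≤⇒≯ (begin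
    d ℕ.+ d                  ≤⟨ ℕ.+-monoʳ-≤ d (ℕ.m≤m+n d (q ℕ.* d)) ⟩
    d ℕ.+ (d ℕ.+ q ℕ.* d)    ≡⟨ sum ⟨
    u ℕ.+ v                  ∎))
  where open ℕ.≤-Reasoning

-- Addition of 1 modulo `d` on representatives; the second case is the wrap-around from `d - 1` to
-- 0.
Successor : ℕ → ℕ → ℕ → Set
Successor d u v = v ≡ suc u ⊎ (v ≡ 0 × suc u ≡ d)

∣-suc⇒successor : ∀ {d u v} → u < d → v < d → + d ∣ + suc u ℤ.- + v → Successor d u v
∣-suc⇒successor {d} {u} {v} u<d v<d d∣ with ℕ.m≤n⇒m<n∨m≡n u<d
... | inj₁ 1+u<d = inj₁ (sym (residues-≡ 1+u<d v<d d∣))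
-- Here `d` is `suc u`, so it divides `- v`, and `v < d` forces `v` to be 0.
... | inj₂ refl  = inj₂ (sym (residues-≡ z<s v<d d∣-v) , refl)
  where
  drop : ∀ d v → (d ℤ.- v) ℤ.- d ≡ + 0 ℤ.- v
  drop = solve-∀
  d∣-v : + suc u ∣ + 0 ℤ.- + v
  d∣-v = subst (+ suc u ∣_) (drop (+ suc u) (+ v)) (∣m∣n⇒∣m-n d∣ ∣-refl)

-- The order on residues in which 0 is moved from the bottom to the top.
Flipped : ℕ → ℕ → Set
Flipped u v = 0 < u × (v ≡ 0 ⊎ u < v)

-- Negation and addition of 1 against the two orders.

+-cancel-< : ∀ {u v u′ v′} → u < v → v ℕ.+ u′ ≡ u ℕ.+ v′ → u′ < v′
+-cancel-< u<v sum = ℕ.≰⇒> λ v′≤u′ →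
  ℕ.<-irrefl (sym sum) (ℕ.+-mono-<-≤ u<v v′≤u′)

-- The new source `u′` is the negative of the old target `v`, and `v′` that of `u`. For nonzero
-- residues exchanging the ends and reversing the order cancel out; an old source 0 becomes a target
-- 0, the top of the flipped order.
<⇒opposite-flipped : ∀ {d u v u′ v′} → Opposite d v u′ → Opposite d u v′ →
                     u < v → Flipped u′ v′
<⇒opposite-flipped (inj₁ (refl , _)) _ ()
<⇒opposite-flipped (inj₂ (_ , u′>0 , _)) (inj₁ (_ , v′≡0)) _ = u′>0 , inj₁ v′≡0
<⇒opposite-flipped (inj₂ (_ , u′>0 , v+u′)) (inj₂ (_ , _ , u+v′)) u<v =
  u′>0 , inj₂ (+-cancel-< u<v (trans v+u′ (sym u+v′)))

flipped⇒opposite-< : ∀ {d u v u′ v′} → Opposite d v u′ → Opposite d u v′ →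
                     Flipped u v → u′ < v′
flipped⇒opposite-< _ (inj₁ (refl , _)) (() , _)
flipped⇒opposite-< (inj₁ (_ , refl)) (inj₂ (_ , v′>0 , _)) _ = v′>0
flipped⇒opposite-< (inj₂ (() , _)) _ (_ , inj₁ refl)
flipped⇒opposite-< (inj₂ (_ , _ , v+u′)) (inj₂ (_ , _ , u+v′)) (_ , inj₂ u<v) =
  +-cancel-< u<v (trans v+u′ (sym u+v′))

opposite-≢0 : ∀ {d u v} → Opposite d u v → u ≢ 0 → v ≢ 0
opposite-≢0 (inj₁ (u≡0 , _)) u≢0 _ = u≢0 u≡0
opposite-≢0 (inj₂ (_ , v>0 , _)) _ v≡0 = ℕ.<-irrefl (sym v≡0) v>0

-- Below `v < d` the residue `u` cannot wrap around, so `u′` is positive. If `v` wraps, it lands on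
-- 0, the top of the flipped order.
<⇒successor-flipped : ∀ {d u v u′ v′} → v < d → Successor d u u′ → Successor d v v′ →
                      u < v → Flipped u′ v′
<⇒successor-flipped v<d (inj₂ (_ , refl)) _ u<v = contradiction v<d (ℕ.≤⇒≯ u<v)
<⇒successor-flipped _ (inj₁ refl) (inj₁ refl) u<v = z<s , inj₂ (s<s u<v)
<⇒successor-flipped _ (inj₁ refl) (inj₂ (v′≡0 , _)) _ = z<s , inj₁ v′≡0

successor-flipped⇒< : ∀ {d u v u′ v′} → u′ < d → Successor d u u′ → Successor d v v′ →
                      Flipped u′ v′ → u < v
successor-flipped⇒< _ (inj₂ (refl , _)) _ (() , _)
-- Here `v` is `d - 1`, and `u + 1 < d` is the claim after cancelling the successor.
successor-flipped⇒< u′<d (inj₁ refl) (inj₂ (_ , refl)) _ = s≤s⁻¹ u′<d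
successor-flipped⇒< _ (inj₁ refl) (inj₁ refl) (_ , inj₂ u′<v′) = s≤s⁻¹ u′<v′

-- The residue map and the edges of `flip I`.

module _ (a : Vector ℕ 3) (a>0 : ∀ i → 0 < a i) where
  open Christoffel a a>0

  F : L → ℤ
  F l = l 0F ℤ.* + a 0F ℤ.+ l 1F ℤ.* + a 1F ℤ.+ l 2F ℤ.* + a 2F

  F-+ : ∀ l m k → (∀ j → k j ≡ l j ℤ.+ m j) → F k ≡ F l ℤ.+ F m
  F-+ l m k k≡ rewrite k≡ 0F | k≡ 1F | k≡ 2F =
    collect (l 0F) (l 1F) (l 2F) (m 0F) (m 1F) (m 2F) (+ a 0F) (+ a 1F) (+ a 2F)
    where
    collect : ∀ x y z x′ y′ z′ a b c →
      (x ℤ.+ x′) ℤ.* a ℤ.+ (y ℤ.+ y′) ℤ.* b ℤ.+ (z ℤ.+ z′) ℤ.* c ≡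
      (x ℤ.* a ℤ.+ y ℤ.* b ℤ.+ z ℤ.* c) ℤ.+ (x′ ℤ.* a ℤ.+ y′ ℤ.* b ℤ.+ z′ ℤ.* c)
    collect = solve-∀

  F-h : ∀ i → F (h i) ≡ + a i
  F-h 0F = e (+ a 0F) (+ a 1F) (+ a 2F)
    where e : ∀ a b c → + 1 ℤ.* a ℤ.+ + 0 ℤ.* b ℤ.+ + 0 ℤ.* c ≡ a
          e = solve-∀
  F-h 1F = e (+ a 0F) (+ a 1F) (+ a 2F)
    where e : ∀ a b c → + 0 ℤ.* a ℤ.+ + 1 ℤ.* b ℤ.+ + 0 ℤ.* c ≡ b
          e = solve-∀
  F-h 2F = e (+ a 0F) (+ a 1F) (+ a 2F)
    where e : ∀ a b c → + 0 ℤ.* a ℤ.+ + 0 ℤ.* b ℤ.+ + 1 ℤ.* c ≡ c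
          e = solve-∀

  F′<s : ∀ l → F′ l < s
  F′<s l = n%ℕd<d (F l) s

  -- Congruences between values of `F′` are obtained by combining this divisibility with the
  -- additivity of `F`.
  s∣F-F′ : ∀ l → + s ∣ F l ℤ.- + F′ l
  s∣F-F′ l = divides (F l /ℕ s)
    (trans (cong (ℤ._- + F′ l) (a≡a%ℕn+[a/ℕn]*n (F l) s)) (drop (+ F′ l) _))
    where
    drop : ∀ r q → (r ℤ.+ q) ℤ.- r ≡ q
    drop = solve-∀

  ker⇒s∣F : ∀ l → l ∈ Ker → + s ∣ F l
  ker⇒s∣F l F′≡0 = subst (+ s ∣_)
    (trans (cong (λ r → F l ℤ.- + r) F′≡0) (ℤ.+-identityʳ (F l))) (s∣F-F′ l)

  a<s : ∀ i → a i < s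
  a<s 0F = ℕ.<-≤-trans (ℕ.m<m+n (a 0F) (a>0 1F)) (ℕ.m≤m+n (a 0F ℕ.+ a 1F) (a 2F))
  a<s 1F = ℕ.<-≤-trans (ℕ.m<n+m (a 1F) (a>0 0F)) (ℕ.m≤m+n (a 0F ℕ.+ a 1F) (a 2F))
  a<s 2F = ℕ.m<n+m (a 2F) (ℕ.<-≤-trans (a>0 0F) (ℕ.m≤m+n (a 0F) (a 1F)))

  -- Equal residues would make `s` divide `a i`, although `0 < a i < s`.
  F′-source≢target : ∀ e → F′ (source e) ≢ F′ (target e)
  F′-source≢target e@(l , i) u≡v =
    ℕ.>⇒∤ {{ℕ.>-nonZero (a>0 i)}} (a<s i) (∣⇒∣ᵤ (subst (+ s ∣_) difference
      (∣m∣n⇒∣m-n (s∣F-F′ (target e)) (s∣F-F′ l))))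
    where
    open ≡-Reasoning
    drop : ∀ x a u → ((x ℤ.+ a) ℤ.- u) ℤ.- (x ℤ.- u) ≡ a
    drop = solve-∀
    difference : (F (target e) ℤ.- + F′ (target e)) ℤ.- (F l ℤ.- + F′ l) ≡ + a i
    difference = begin
      (F (target e) ℤ.- + F′ (target e)) ℤ.- (F l ℤ.- + F′ l)
        ≡⟨ cong₂ (λ x v → (x ℤ.- + v) ℤ.- (F l ℤ.- + F′ l))
             (trans (F-+ l (h i) (target e) λ _ → refl) (cong (λ k → F l ℤ.+ k) (F-h i))) (sym u≡v) ⟩
      ((F l ℤ.+ + a i) ℤ.- + F′ l) ℤ.- (F l ℤ.- + F′ l)
        ≡⟨ drop (F l) (+ a i) (+ F′ l) ⟩
      + a i ∎

  -- An edge of `Q′` has exactly one end of residue 0 and lies in `I` exactly when that end is its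
  -- source. Flipping thus retains the edges of `Q′` with target 0, the top of the flipped order.
  flip⇒flipped : ∀ e → e ∈ flip I → Flipped (F′ (source e)) (F′ (target e))
  flip⇒flipped e (inj₁ (u<v , ∉Q′)) = ℕ.n≢0⇒n>0 (λ u≡0 → ∉Q′ (inj₁ u≡0)) , inj₂ u<v
  flip⇒flipped e (inj₂ (inj₁ u≡0 , u≮v)) = contradiction
    (subst (_< F′ (target e)) (sym u≡0)
      (ℕ.n≢0⇒n>0 λ v≡0 → F′-source≢target e (trans u≡0 (sym v≡0)))) u≮v
  flip⇒flipped e (inj₂ (inj₂ v≡0 , _)) =
    ℕ.n≢0⇒n>0 (λ u≡0 → F′-source≢target e (trans u≡0 (sym v≡0))) , inj₁ v≡0

  flipped⇒flip : ∀ e → Flipped (F′ (source e)) (F′ (target e)) → e ∈ flip I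
  flipped⇒flip e (_ , inj₁ v≡0) =
    inj₂ (inj₂ v≡0 , λ u<v → ℕ.n≮0 (subst (F′ (source e) <_) v≡0 u<v))
  flipped⇒flip e (0<u , inj₂ u<v) = inj₁ (u<v , λ where
    (inj₁ u≡0) → ℕ.<-irrefl (sym u≡0) 0<u
    (inj₂ v≡0) → ℕ.n≮0 (subst (F′ (source e) <_) v≡0 u<v))

  -- Edges under the point symmetry.

  module _ (w : L) (s∣w : + s ∣ F w) where

    -- The target and `l′` add up to `w`, whose value under `F` is a multiple of `s`, so their
    -- residues sum to 0 modulo `s`.
    reversed⇒opposite : ∀ i l l′ → Reversed w i l l′ → Opposite s (F′ (target (l , i))) (F′ l′)
    reversed⇒opposite i l l′ r =
      ∣-sum⇒opposite (F′<s m) (F′<s l′) (∣⇒∣ᵤ (subst (+ s ∣_) sum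
        (∣m∣n⇒∣m-n s∣w (∣m∣n⇒∣m+n (s∣F-F′ m) (s∣F-F′ l′)))))
      where
      m = target (l , i)
      drop : ∀ x y u v → (x ℤ.+ y) ℤ.- ((x ℤ.- u) ℤ.+ (y ℤ.- v)) ≡ u ℤ.+ v
      drop = solve-∀
      sum : F w ℤ.- ((F m ℤ.- + F′ m) ℤ.+ (F l′ ℤ.- + F′ l′)) ≡ + (F′ m ℕ.+ F′ l′)
      sum = trans (cong (ℤ._- ((F m ℤ.- + F′ m) ℤ.+ (F l′ ℤ.- + F′ l′))) (F-+ m l′ w r))
                  (drop (F m) (F l′) (+ F′ m) (+ F′ l′))

    reversed⇒opposite′ : ∀ i l l′ → Reversed w i l l′ → Opposite s (F′ l) (F′ (target (l′ , i)))
    reversed⇒opposite′ i l l′ r =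
      opposite-sym (reversed⇒opposite i l′ l (reversed-sym w i l l′ r))

    reversed-I : ∀ i l l′ → Reversed w i l l′ → (l , i) ∈ I → (l′ , i) ∈ flip I
    reversed-I i l l′ r u<v = flipped⇒flip (l′ , i)
      (<⇒opposite-flipped (reversed⇒opposite i l l′ r) (reversed⇒opposite′ i l l′ r) u<v)

    reversed-flip : ∀ i l l′ → Reversed w i l l′ → (l , i) ∈ flip I → (l′ , i) ∈ I
    reversed-flip i l l′ r e∈ = flipped⇒opposite-<
      (reversed⇒opposite i l l′ r) (reversed⇒opposite′ i l l′ r) (flip⇒flipped (l , i) e∈)

    reversed-body : ∀ i l l′ → Reversed w i l l′ → (l , i) ∈ I ∖ Q′ → (l′ , i) ∈ I ∖ Q′
    reversed-body i l l′ r (u<v , ∉Q′) =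
      -- Body edges also belong to `flip I`, so the reversed edge lies in `I`; negation keeps
      -- nonzero residues nonzero, so it avoids `Q′`.
      reversed-flip i l l′ r (inj₁ (u<v , ∉Q′)) , λ where
        (inj₁ u′≡0) → opposite-≢0 (reversed⇒opposite i l l′ r) (λ v≡0 → ∉Q′ (inj₂ v≡0)) u′≡0
        (inj₂ v′≡0) → opposite-≢0 (reversed⇒opposite′ i l l′ r) (λ u≡0 → ∉Q′ (inj₁ u≡0)) v′≡0

  -- Edges under translation by a vector of residue -1.

  module _ (t : L) (Ft≡-1 : F t ≡ ℤ.-1ℤ) where

    -- From `l = l′ + t` and `F t = -1` follows `F l′ = F l + 1`.
    translated⇒successor : ∀ l l′ → Translated t l l′ → Successor s (F′ l) (F′ l′)
    translated⇒successor l l′ r =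
      ∣-suc⇒successor (F′<s l) (F′<s l′) (subst (+ s ∣_) difference
        (∣m∣n⇒∣m-n (s∣F-F′ l′) (s∣F-F′ l)))
      where
      drop : ∀ x u v → (x ℤ.- v) ℤ.- ((x ℤ.+ ℤ.-1ℤ) ℤ.- u) ≡ (1ℤ ℤ.+ u) ℤ.- v
      drop = solve-∀
      difference : (F l′ ℤ.- + F′ l′) ℤ.- (F l ℤ.- + F′ l) ≡ + suc (F′ l) ℤ.- + F′ l′
      difference = trans
        (cong (λ x → (F l′ ℤ.- + F′ l′) ℤ.- (x ℤ.- + F′ l))
          (trans (F-+ l′ t l r) (cong (λ k → F l′ ℤ.+ k) Ft≡-1)))
        (drop (F l′) (+ F′ l) (+ F′ l′))

    translated-I : ∀ i l l′ → Translated t l l′ → (l , i) ∈ I → (l′ , i) ∈ flip I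
    translated-I i l l′ r u<v = flipped⇒flip (l′ , i)
      (<⇒successor-flipped (F′<s (target (l , i))) (translated⇒successor l l′ r)
        (translated⇒successor (target (l , i)) (target (l′ , i)) (translated-target t l l′ i r)) u<v)

    translated-flip : ∀ i l l′ → Translated t l l′ → (l′ , i) ∈ flip I → (l , i) ∈ I
    translated-flip i l l′ r e∈ =
      successor-flipped⇒< (F′<s l′) (translated⇒successor l l′ r)
        (translated⇒successor (target (l , i)) (target (l′ , i)) (translated-target t l l′ i r))
        (flip⇒flipped (l′ , i) e∈)

  -- Substituting the Bézout identity of the first two entries into that of their gcd with the third
  -- writes 1 as a combination of all three; `t` negates its coefficients.
  F≡-1-solvable : gcd (gcd (a 0F) (a 1F)) (a 2F) ≡ 1 → ∃ λ t → F t ≡ ℤ.-1ℤ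
  F≡-1-solvable coprime with ℤ-bézout (a 0F) (a 1F) | ℤ-bézout (gcd (a 0F) (a 1F)) (a 2F)
  ... | p , q , pq | x , y , xy = t , (begin
    F t
      ≡⟨ regroup p q x y (+ a 0F) (+ a 1F) (+ a 2F) ⟩
    ℤ.- (x ℤ.* (p ℤ.* + a 0F ℤ.+ q ℤ.* + a 1F) ℤ.+ y ℤ.* + a 2F)
      ≡⟨ cong (λ g → ℤ.- (x ℤ.* g ℤ.+ y ℤ.* + a 2F)) pq ⟩
    ℤ.- (x ℤ.* + gcd (a 0F) (a 1F) ℤ.+ y ℤ.* + a 2F)
      ≡⟨ cong ℤ.-_ (trans xy (cong +_ coprime)) ⟩
    ℤ.-1ℤ ∎)
    where
    open ≡-Reasoning
    t : L
    t 0F = ℤ.- (x ℤ.* p)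
    t 1F = ℤ.- (x ℤ.* q)
    t 2F = ℤ.- y
    regroup : ∀ p q x y a b c →
      (ℤ.- (x ℤ.* p)) ℤ.* a ℤ.+ (ℤ.- (x ℤ.* q)) ℤ.* b ℤ.+ (ℤ.- y) ℤ.* c ≡
      ℤ.- (x ℤ.* (p ℤ.* a ℤ.+ q ℤ.* b) ℤ.+ y ℤ.* c)
    regroup = solve-∀

  -- Traces on the parallelogram.

  module _ (v₁ v₂ : L) where
    private
      P = parallelogram ⟦ v₁ ⟧ ⟦ v₂ ⟧
      w = ⟦ v₁ ⟧ ⊕ ⟦ v₂ ⟧

    -- Kept general in the edge sets so as to cover both the body, with `X` and `Y` equal, and the
    -- passage from `I` to `flip I`. The symmetry is its own inverse.
    reflected-trace : ∀ (X Y : Pred Edge 0ℓ) →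
      (∀ i l l′ → Reversed (v₁ +ᴸ v₂) i l l′ → (l , i) ∈ X → (l′ , i) ∈ Y) →
      (∀ i l l′ → Reversed (v₁ +ᴸ v₂) i l l′ → (l , i) ∈ Y → (l′ , i) ∈ X) →
      act (w ⊝_) (Tr P X) ≐ Tr P Y
    reflected-trace X Y X→Y Y→X = act-Tr {w ⊝_} {w ⊝_} {P} {P} {X} {Y}
      (⊝-involutive w) (parallelogram-resp ⟦ v₁ ⟧ ⟦ v₂ ⟧)
      (parallelogram-symmetric ⟦ v₁ ⟧ ⟦ v₂ ⟧ , parallelogram-symmetric ⟦ v₁ ⟧ ⟦ v₂ ⟧)
      (λ l i e∈X → let (l′ , r) = reversed-exists (v₁ +ᴸ v₂) i l in
        l′ , X→Y i l l′ r e∈X , reversed-carries v₁ v₂ i l l′ r)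
      (λ l′ i e∈Y → let (l , r) = reversed-exists (v₁ +ᴸ v₂) i l′ in
        l , Y→X i l′ l r e∈Y ,
        reversed-carries v₁ v₂ i l l′ (reversed-sym (v₁ +ᴸ v₂) i l′ l r))

    translated-trace : ∀ t → F t ≡ ℤ.-1ℤ →
      act (_⊝ ⟦ t ⟧) (Tr (image (_⊕ ⟦ t ⟧) P) I) ≐ Tr P (flip I)
    translated-trace t Ft≡-1 = act-Tr {_⊝ ⟦ t ⟧} {_⊕ ⟦ t ⟧} {image (_⊕ ⟦ t ⟧) P} {P} {I} {flip I}
      (⊕-⊝-cancel ⟦ t ⟧) (parallelogram-resp ⟦ v₁ ⟧ ⟦ v₂ ⟧)
      (translate-carries ⟦ t ⟧ P (parallelogram-resp ⟦ v₁ ⟧ ⟦ v₂ ⟧))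
      (λ l i e∈I → let l′ = λ j → l j ℤ.- t j
                       r = λ j → undo (l j) (t j) in
        l′ , translated-I t Ft≡-1 i l l′ r e∈I , translated-carries t l l′ i r)
      (λ l′ i e∈flip → let l = l′ +ᴸ t in
        l , translated-flip t Ft≡-1 i l l′ (λ _ → refl) e∈flip ,
        translated-carries t l l′ i (λ _ → refl))

corollary26 : (a : Vector ℕ 3) (a>0 : ∀ i → 0 < a i) →
    gcd (gcd (a 0F) (a 1F)) (a 2F) ≡ 1 →
    let open Christoffel a a>0 in
    (v₁ v₂ : L) → IsBasisOfKer v₁ v₂ →
    let P = parallelogram ⟦ v₁ ⟧ ⟦ v₂ ⟧
        ρ = λ x → (⟦ v₁ ⟧ ⊕ ⟦ v₂ ⟧) ⊝ x
    in
    (act ρ (Tr P (I ∖ Q′)) ≐ Tr P (I ∖ Q′))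
    ×
    (∃ λ t → act ρ (Tr P I) ≐ act (_⊝ ⟦ t ⟧) (Tr (image (_⊕ ⟦ t ⟧) P) I))
    ×
    (act ρ (Tr P I) ≐ Tr P (flip I))
corollary26 a a>0 coprime v₁ v₂ (v₁∈Ker , v₂∈Ker , _) =
  reflected-trace a a>0 v₁ v₂ (I ∖ Q′) (I ∖ Q′) body body ,
  -- The reflected trace and the translated one are compared through `Tr P (flip I)`, to which both
  -- are equal.
  (t , ≐-trans reflection (≐-sym (translated-trace a a>0 v₁ v₂ t Ft≡-1))) ,
  reflection
  where
  open Christoffel a a>0
  w = v₁ +ᴸ v₂

  s∣w : + s ∣ F a a>0 w
  s∣w = subst (+ s ∣_) (sym (F-+ a a>0 v₁ v₂ w λ _ → refl))
    (∣m∣n⇒∣m+n (ker⇒s∣F a a>0 v₁ v₁∈Ker) (ker⇒s∣F a a>0 v₂ v₂∈Ker))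

  body = reversed-body a a>0 w s∣w

  reflection : act (λ x → (⟦ v₁ ⟧ ⊕ ⟦ v₂ ⟧) ⊝ x) (Tr (parallelogram ⟦ v₁ ⟧ ⟦ v₂ ⟧) I) ≐
               Tr (parallelogram ⟦ v₁ ⟧ ⟦ v₂ ⟧) (flip I)
  reflection = reflected-trace a a>0 v₁ v₂ I (flip I) (reversed-I a a>0 w s∣w) (reversed-flip a a>0 w s∣w)

  t = proj₁ (F≡-1-solvable a a>0 coprime)
  Ft≡-1 = proj₂ (F≡-1-solvable a a>0 coprime)
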